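{- Let $G$ be a strongly connected digraph. Then its Kirchhoff polynomial $\kappa(G)$ is prime.
   Context: Digraphs are finite directed graphs without loops; parallel edges are allowed. An arborescence of a digraph $G=(V,E)$ is a subdigraph $A$ spanning all of $V$ with a root vertex from which every vertex is reachable along a unique directed path in $A$ (a rooted directed spanning tree with edges directed away from the root). Arborescences are identified with their edge sets. Let $\mathsf{arb}(G)$ be the set of all arborescences of $G$ (over all roots). Each edge $e\in E$ is regarded as a variable, distinct edges being distinct variables. The Kirchhoff polynomial is $\kappa(G)=\sum_{A\in\mathsf{arb}(G)}\prod_{e\in A}e\in\mathbb{Q}[e : e\in E]$; for a one-vertex digraph $\kappa(G)=1$. A polynomial is called prime if it has only trivial factors, i.e. whenever it equals $P\cdot Q$, one of $P,Q$ is a constant (with this convention the constant $1$ counts as prime). $G$ is strongly connected if for any two vertices $u,w$ there are directed paths from $u$ to $w$ and from $w$ to $u$. -}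

module Defs where

open import Data.Empty using (⊥-elim)
open import Data.Fin.Base as Fin using (Fin; toℕ)
open import Data.Fin.Properties using (_≟_; any?; all?; pigeonhole; toℕ<n)
open import Data.Fin.Subset using (Subset; _∈_; inside; outside; ⊤)
open import Data.Fin.Subset.Properties using (_∈?_)
open import Data.List.Base
  using (List; []; _∷_; map; filter; foldr; concatMap; _++_; allFin; length; take)
open import Data.List.Properties using (length-take) renaming (≡-dec to List-≡-dec)
open import Data.Nat.Base as ℕ using (ℕ; zero; suc; z≤n; s≤s)
import Data.Nat.Properties as ℕₚ
open import Data.Product.Base using (∃; _×_; _,_; proj₁; proj₂)
open import Data.Product using (∃!)
open import Data.Rational.Base as ℚ using (ℚ; 0ℚ; 1ℚ)
open import Data.Sum.Base using (_⊎_)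
open import Data.Vec.Base using (Vec; []; _∷_; replicate; zipWith; _[_]≔_)
import Data.Vec.Properties as Vecₚ
open import Level using (Level)
open import Relation.Binary.PropositionalEquality
  using (_≡_; _≢_; refl; sym; trans; cong; subst)
open import Relation.Nullary using (¬_; Dec; yes; no)
open import Relation.Nullary.Decidable
  using (map′; _×-dec_; _→-dec_; ¬?; decidable-stable)
open import Relation.Unary using (Pred; Decidable)

-- A polynomial over ℚ in m variables is a finite formal sum of terms (coefficient , exponents).
-- Terms may repeat and coefficients may be zero, so equality of
-- polynomials is _≈_ below and not _≡_.

Poly : ℕ → Set
Poly m = List (ℚ × Vec ℕ m)

coeff : ∀ {m} → Poly m → Vec ℕ m → ℚ
coeff P μ =
  foldr ℚ._+_ 0ℚ (map proj₁ (filter (λ t → Vecₚ.≡-dec ℕₚ._≟_ (proj₂ t) μ) P))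

infix 4 _≈_

_≈_ : ∀ {m} → Poly m → Poly m → Set
P ≈ Q = ∀ μ → coeff P μ ≡ coeff Q μ

const : ∀ {m} → ℚ → Poly m
const c = (c , replicate _ 0) ∷ []

var : ∀ {m} → Fin m → Poly m
var i = (1ℚ , replicate _ 0 [ i ]≔ 1) ∷ []

infixl 6 _+_
infixl 7 _*_

_+_ : ∀ {m} → Poly m → Poly m → Poly m
P + Q = P ++ Q

_*_ : ∀ {m} → Poly m → Poly m → Poly m
P * Q = concatMap (λ (a , μ) → map (λ (b , ν) → a ℚ.* b , zipWith ℕ._+_ μ ν) Q) P

∑ : ∀ {m} {I : Set} → List I → (I → Poly m) → Poly m
∑ is f = foldr _+_ (const 0ℚ) (map f is)

∏ : ∀ {m} {I : Set} → List I → (I → Poly m) → Poly m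
∏ is f = foldr _*_ (const 1ℚ) (map f is)

IsConstant : ∀ {m} → Poly m → Set
IsConstant P = ∃ λ c → P ≈ const c

Prime : ∀ {m} → Poly m → Set
Prime F = ∀ P Q → F ≈ P * Q → IsConstant P ⊎ IsConstant Q

record Digraph : Set where
  field
    #V       : ℕ
    #E       : ℕ
    src      : Fin #E → Fin #V
    tgt      : Fin #E → Fin #V
    loopless : ∀ e → src e ≢ tgt e

  V : Set
  V = Fin #V

  E : Set
  E = Fin #E

open Digraph

-- IsPath G A u es w: the edges es, in this order, lead from u to w inside A.
-- Vertices may repeat, so that uniqueness of paths from a root r makes the
-- edges of A a tree: together with an edge r → v, an edge v → r would give
-- a second path from r to r besides the empty one.

IsPath : (G : Digraph) → Subset (#E G) → V G → List (E G) → V G → Set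
IsPath G A u []       w = u ≡ w
IsPath G A u (e ∷ es) w = e ∈ A × src G e ≡ u × IsPath G A (tgt G e) es w

StronglyConnected : Digraph → Set
StronglyConnected G =
  ∀ u w → ∃ (λ es → IsPath G ⊤ u es w) × ∃ (λ es → IsPath G ⊤ w es u)

HasRoot : (G : Digraph) → Subset (#E G) → V G → Set
HasRoot G A r = ∀ v → ∃! _≡_ (λ es → IsPath G A r es v)

IsArborescence : (G : Digraph) → Subset (#E G) → Set
IsArborescence G A = ∃ (HasRoot G A)

-- Being an arborescence is decidable.  Uniqueness of paths ranges over
-- infinitely many edge sequences; by the pigeonhole principle it suffices
-- to test those of length at most the number of vertices.

private
  variable
    p : Level

  anyList? : ∀ {m} {P : Pred (List (Fin m)) p} → Decidable P →
             ∀ k → Dec (∃ λ es → length es ℕ.≤ k × P es)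
  anyList? P? zero = map′ (λ q → [] , z≤n , q) (λ { ([] , _ , q) → q }) (P? [])
  anyList? P? (suc k) with P? [] | any? (λ e → anyList? (λ es → P? (e ∷ es)) k)
  ... | yes q | _                      = yes ([] , z≤n , q)
  ... | no _  | yes (e , es , l , q)   = yes (e ∷ es , s≤s l , q)
  ... | no ¬q | no ¬r                  =
    no λ { ([] , _ , q) → ¬q q ; (e ∷ es , s≤s l , q) → ¬r (e , es , l , q) }

  allList? : ∀ {m} {P : Pred (List (Fin m)) p} → Decidable P →
             ∀ k → Dec (∀ es → length es ℕ.≤ k → P es)
  allList? P? k with anyList? (λ es → ¬? (P? es)) k
  ... | yes (es , l , ¬q) = no λ all → ¬q (all es l)
  ... | no ¬any           =
    yes λ es l → decidable-stable (P? es) (λ ¬q → ¬any (es , l , ¬q))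

module _ (G : Digraph) (A : Subset (#E G)) where

  private
    Path : V G → List (E G) → V G → Set
    Path = IsPath G A

    path? : ∀ u es w → Dec (Path u es w)
    path? u []       w = u ≟ w
    path? u (e ∷ es) w = (e ∈? A) ×-dec ((src G e ≟ u) ×-dec path? (tgt G e) es w)

    prefix : ∀ u es w → Path u es w → ∀ k → ∃ (Path u (take k es))
    prefix u es       w q             zero    = u , refl
    prefix u []       w q             (suc k) = u , refl
    prefix u (e ∷ es) w (e∈A , s , q) (suc k) =
      let v , q′ = prefix (tgt G e) es w q k in v , e∈A , s , q′

    BoundedUnique : V G → Set
    BoundedUnique r =
      ∀ v es → length es ℕ.≤ #V G → Path r es v →
      ∀ fs → length fs ℕ.≤ #V G → Path r fs v → es ≡ fs

    boundedUnique? : Decidable BoundedUnique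
    boundedUnique? r = all? λ v →
      map′ (λ h es l → h es l) (λ h es l → h es l)
        (allList? (λ es → path? r es v →-dec
          allList? (λ fs → path? r fs v →-dec List-≡-dec _≟_ es fs) (#V G)) (#V G))

    short : ∀ r → BoundedUnique r → ∀ v es → Path r es v → length es ℕ.≤ #V G
    short r unique v es q with length es ℕₚ.≤? #V G
    ... | yes l = l
    ... | no ¬l = ⊥-elim contra
      where
      len : ∀ (i : Fin (suc (#V G))) → length (take (toℕ i) es) ≡ toℕ i
      len i = trans (length-take (toℕ i) es)
        (ℕₚ.m≤n⇒m⊓n≡m (ℕₚ.≤-trans (ℕₚ.<⇒≤ (toℕ<n i)) (ℕₚ.≰⇒> ¬l)))

      bound : ∀ i → length (take (toℕ i) es) ℕ.≤ #V G
      bound i = subst (ℕ._≤ #V G) (sym (len i)) (ℕₚ.≤-pred (toℕ<n i))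

      end : Fin (suc (#V G)) → V G
      end i = proj₁ (prefix r es v q (toℕ i))

      contra : _
      contra with pigeonhole (ℕₚ.n<1+n (#V G)) end
      ... | i , j , i<j , eq = ℕₚ.<⇒≢ i<j
        (trans (sym (len i)) (trans (cong length same) (len j)))
        where
        same : take (toℕ i) es ≡ take (toℕ j) es
        same = unique (end j)
          (take (toℕ i) es) (bound i)
          (subst (Path r _) eq (proj₂ (prefix r es v q (toℕ i))))
          (take (toℕ j) es) (bound j) (proj₂ (prefix r es v q (toℕ j)))

    hasRoot? : Decidable (HasRoot G A)
    hasRoot? r = map′ to from
      (boundedUnique? r ×-dec all? (λ v → anyList? (λ es → path? r es v) (#V G)))
      where
      to : BoundedUnique r × (∀ v → ∃ λ es → length es ℕ.≤ #V G × Path r es v) →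
           HasRoot G A r
      to (unique , reach) v =
        let es , l , q = reach v in
        es , q , λ {fs} q′ → unique v es l q fs (short r unique v fs q′) q′

      from : HasRoot G A r →
             BoundedUnique r × (∀ v → ∃ λ es → length es ℕ.≤ #V G × Path r es v)
      from h = unique , λ v →
        let es , q , _ = h v in es , short r unique v es q , q
        where
        unique : BoundedUnique r
        unique v es _ q fs _ q′ =
          let _ , _ , u = h v in trans (sym (u q)) (u q′)

  isArborescence? : Dec (IsArborescence G A)
  isArborescence? = any? hasRoot?

subsets : ∀ m → List (Subset m)
subsets zero    = [] ∷ []
subsets (suc m) = map (outside ∷_) (subsets m) ++ map (inside ∷_) (subsets m)

arb : (G : Digraph) → List (Subset (#E G))
arb G = filter (isArborescence? G) (subsets (#E G))

κ : (G : Digraph) → Poly (#E G)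
κ G = ∑ (arb G) λ A → ∏ (filter (_∈? A) (allFin (#E G))) var

{-# OPTIONS --safe #-}

-- If κ(G) = P Q, then, κ(G) being affine in every variable e, comparing leading monomials for a
-- lexicographic order with e in front shows that e occurs in at most one of P and Q.  So no two
-- pairs of monomials of P and Q have the same product, and the monomials of P Q are all these
-- products: parts of two arborescences, one taken from the variables of P and the other from
-- those of Q, always combine to an arborescence.
--
-- Combining arborescences through two given edges shows that edges with the same target are
-- variables of the same factor.  If both factors had variables, there would be arborescences with
-- roots r and r′ whose entering edges belong to P and to Q respectively.  Combining the Q-part of
-- the former with the P-part of the latter gives an arborescence entering every vertex, including
-- its own root, which is absurd.

module Submission where

open import Defs

open import Data.Bool.Base using (Bool; true; false)
import Data.Bool.Properties as Boolₚ
open import Data.Empty using (⊥)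
open import Data.Fin.Base using (Fin)
import Data.Fin.Properties as Finₚ
open import Data.Fin.Subset using (Subset; _∈_; ⊤; inside; outside)
open import Data.Fin.Subset.Properties using (_∈?_)
open import Data.List.Base using (List; []; _∷_; _∷ʳ_; map; filter; foldr; _++_; length; allFin)
import Data.List.Extrema as Extrema
open import Data.List.Membership.Propositional using (find; lose)
  renaming (_∈_ to _∈ˡ_; _∉_ to _∉ˡ_)
open import Data.List.Membership.Propositional.Properties
  using (∈-map⁺; ∈-map⁻; ∈-++⁺ˡ; ∈-++⁺ʳ; ∈-++⁻; ∈-filter⁺; ∈-filter⁻; ∈-allFin)
open import Data.List.Properties using (filter-reject; length-filter; ∷ʳ-injectiveʳ)
open import Data.List.Relation.Unary.All as All using (All; []; _∷_)
open import Data.List.Relation.Unary.All.Properties using (all-filter)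
open import Data.List.Relation.Unary.AllPairs using ([]; _∷_)
open import Data.List.Relation.Unary.Any as Any using (here; there)
open import Data.List.Relation.Unary.Unique.Propositional using (Unique)
import Data.List.Relation.Unary.Unique.Propositional.Properties as Uniqueₚ
open import Data.List.Reverse using (Reverse; reverseView; []; _∶_∶ʳ_)
open import Data.Maybe.Base using (Maybe; just; nothing)
open import Data.Maybe.Properties using (just-injective) renaming (≡-dec to Maybe-≡-dec)
open import Data.Nat.Base as ℕ using (ℕ; zero; suc; z≤n; s≤s)
open import Data.Nat.Induction using (<-wellFounded)
import Data.Nat.Properties as ℕₚ
open import Data.Product.Base using (∃; ∃₂; _×_; _,_; proj₁; proj₂)
open import Data.Rational.Base as ℚ using (ℚ; 0ℚ; 1ℚ)
import Data.Rational.Properties as ℚₚ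
open import Data.Sum.Base using (_⊎_; inj₁; inj₂)
open import Data.Vec.Base using (Vec; []; _∷_; zipWith; lookup; replicate; tabulate; _[_]≔_)
import Data.Vec.Properties as Vecₚ
open import Data.Vec.Relation.Binary.Lex.Core using (base; this; next)
import Data.Vec.Relation.Binary.Lex.Strict as Lex
open import Function.Base using (_∘_)
open import Induction.WellFounded using (Acc; acc)
open import Relation.Binary.Bundles using (TotalOrder)
open import Relation.Binary.PropositionalEquality
open import Relation.Nullary using (Dec; yes; no; does; contradiction)
open import Relation.Nullary.Decidable using (_×-dec_; ¬?; dec-true; decidable-stable; from-yes)
open import Relation.Unary using (Pred; Decidable)

open ≡-Reasoning

private
  variable
    m k : ℕ

-- Polynomials and their supports

Monomial : ℕ → Set
Monomial = Vec ℕ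

infix 4 _≟_
_≟_ : (μ ν : Monomial m) → Dec (μ ≡ ν)
_≟_ = Vecₚ.≡-dec ℕₚ._≟_

infixl 6 _⊕_
_⊕_ : Monomial m → Monomial m → Monomial m
_⊕_ = zipWith ℕ._+_

Supp : Poly m → Monomial m → Set
Supp P μ = coeff P μ ≢ 0ℚ

supp? : (P : Poly m) (μ : Monomial m) → Dec (Supp P μ)
supp? P μ = ¬? (coeff P μ ℚₚ.≟ 0ℚ)

δ : Monomial m → Monomial m → ℚ
δ ρ μ with μ ≟ ρ
... | yes _ = 1ℚ
... | no _  = 0ℚ

δ-≡ : ∀ (μ : Monomial m) → δ μ μ ≡ 1ℚ
δ-≡ μ with μ ≟ μ
... | yes _   = refl
... | no μ≢μ = contradiction refl μ≢μ

δ-≢ : ∀ {ρ μ : Monomial m} → μ ≢ ρ → δ ρ μ ≡ 0ℚ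
δ-≢ {ρ = ρ} {μ} μ≢ρ with μ ≟ ρ
... | yes eq = contradiction eq μ≢ρ
... | no _   = refl

-- The linear functional on polynomials that sends the monomial μ to f μ.
eval : (Monomial m → ℚ) → Poly m → ℚ
eval f []            = 0ℚ
eval f ((a , μ) ∷ P) = a ℚ.* f μ ℚ.+ eval f P

coeff-∷ : ∀ a (μ : Monomial m) P ρ →
          coeff ((a , μ) ∷ P) ρ ≡ a ℚ.* δ ρ μ ℚ.+ coeff P ρ
coeff-∷ a μ P ρ with μ ≟ ρ
... | yes _ = cong (ℚ._+ coeff P ρ) (sym (ℚₚ.*-identityʳ a))
... | no _  = sym (trans (cong (ℚ._+ coeff P ρ) (ℚₚ.*-zeroʳ a)) (ℚₚ.+-identityˡ _))

-- A coefficient is the value of a linear functional, so coefficients of a product become iterated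
-- sums through `eval-*`.
coeff-eval : ∀ (P : Poly m) ρ → coeff P ρ ≡ eval (δ ρ) P
coeff-eval []            ρ = refl
coeff-eval ((a , μ) ∷ P) ρ =
  trans (coeff-∷ a μ P ρ) (cong (a ℚ.* δ ρ μ ℚ.+_) (coeff-eval P ρ))

eval-++ : ∀ f (P Q : Poly m) → eval f (P ++ Q) ≡ eval f P ℚ.+ eval f Q
eval-++ f []            Q = sym (ℚₚ.+-identityˡ _)
eval-++ f ((a , μ) ∷ P) Q =
  trans (cong (a ℚ.* f μ ℚ.+_) (eval-++ f P Q))
    (sym (ℚₚ.+-assoc (a ℚ.* f μ) (eval f P) (eval f Q)))

eval-scale : ∀ f a (μ : Monomial m) Q →
             eval f (map (λ (b , ν) → a ℚ.* b , μ ⊕ ν) Q) ≡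
             a ℚ.* eval (λ ν → f (μ ⊕ ν)) Q
eval-scale f a μ []            = sym (ℚₚ.*-zeroʳ a)
eval-scale f a μ ((b , ν) ∷ Q) = trans
  (cong₂ ℚ._+_ (ℚₚ.*-assoc a b _) (eval-scale f a μ Q))
  (sym (ℚₚ.*-distribˡ-+ a _ _))

eval-* : ∀ f (P Q : Poly m) →
         eval f (P * Q) ≡ eval (λ μ → eval (λ ν → f (μ ⊕ ν)) Q) P
eval-* f []            Q = refl
eval-* f ((a , μ) ∷ P) Q = trans
  (eval-++ f (map _ Q) (P * Q))
  (cong₂ ℚ._+_ (eval-scale f a μ Q) (eval-* f P Q))

eval-*ʳ : ∀ c f (P : Poly m) → eval (λ μ → f μ ℚ.* c) P ≡ eval f P ℚ.* c
eval-*ʳ c f []            = sym (ℚₚ.*-zeroˡ c)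
eval-*ʳ c f ((a , μ) ∷ P) = trans
  (cong₂ ℚ._+_ (sym (ℚₚ.*-assoc a (f μ) c)) (eval-*ʳ c f P))
  (sym (ℚₚ.*-distribʳ-+ c (a ℚ.* f μ) (eval f P)))

eval-0 : ∀ (P : Poly m) → eval (λ _ → 0ℚ) P ≡ 0ℚ
eval-0 []            = refl
eval-0 ((a , μ) ∷ P) = trans (cong₂ ℚ._+_ (ℚₚ.*-zeroʳ a) (eval-0 P)) (ℚₚ.+-identityˡ 0ℚ)

without : Monomial m → Poly m → Poly m
without μ = filter (λ t → ¬? (proj₂ t ≟ μ))

-- The terms with monomial `μ`, which may be scattered over the list, are collected into a single
-- one; this drives the recursion in `eval-cong`.
eval-without : ∀ f μ (P : Poly m) →
               eval f P ≡ coeff P μ ℚ.* f μ ℚ.+ eval f (without μ P)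
eval-without f μ []            = sym (trans (ℚₚ.+-identityʳ (0ℚ ℚ.* f μ)) (ℚₚ.*-zeroˡ (f μ)))
eval-without f μ ((a , ν) ∷ P) with ν ≟ μ
... | yes refl = begin
  a ℚ.* f ν ℚ.+ eval f P
    ≡⟨ cong (a ℚ.* f ν ℚ.+_) (eval-without f ν P) ⟩
  a ℚ.* f ν ℚ.+ (coeff P ν ℚ.* f ν ℚ.+ eval f (without ν P))
    ≡⟨ ℚₚ.+-assoc (a ℚ.* f ν) (coeff P ν ℚ.* f ν) (eval f (without ν P)) ⟨
  a ℚ.* f ν ℚ.+ coeff P ν ℚ.* f ν ℚ.+ eval f (without ν P)
    ≡⟨ cong (ℚ._+ _) (ℚₚ.*-distribʳ-+ (f ν) a (coeff P ν)) ⟨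
  (a ℚ.+ coeff P ν) ℚ.* f ν ℚ.+ eval f (without ν P) ∎
... | no _ = begin
  a ℚ.* f ν ℚ.+ eval f P
    ≡⟨ cong (a ℚ.* f ν ℚ.+_) (eval-without f μ P) ⟩
  a ℚ.* f ν ℚ.+ (coeff P μ ℚ.* f μ ℚ.+ eval f (without μ P))
    ≡⟨ ℚₚ.+-assoc (a ℚ.* f ν) (coeff P μ ℚ.* f μ) (eval f (without μ P)) ⟨
  a ℚ.* f ν ℚ.+ coeff P μ ℚ.* f μ ℚ.+ eval f (without μ P)
    ≡⟨ cong (ℚ._+ _) (ℚₚ.+-comm (a ℚ.* f ν) _) ⟩
  coeff P μ ℚ.* f μ ℚ.+ a ℚ.* f ν ℚ.+ eval f (without μ P)
    ≡⟨ ℚₚ.+-assoc (coeff P μ ℚ.* f μ) (a ℚ.* f ν) (eval f (without μ P)) ⟩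
  coeff P μ ℚ.* f μ ℚ.+ (a ℚ.* f ν ℚ.+ eval f (without μ P)) ∎

coeff-without-≡ : ∀ μ (P : Poly m) → coeff (without μ P) μ ≡ 0ℚ
coeff-without-≡ μ []            = refl
coeff-without-≡ μ ((a , ν) ∷ P) with ν ≟ μ in eq
... | yes _ = coeff-without-≡ μ P
... | no _ rewrite eq = coeff-without-≡ μ P

coeff-without-≢ : ∀ {μ ρ} (P : Poly m) → μ ≢ ρ → coeff (without μ P) ρ ≡ coeff P ρ
coeff-without-≢ {μ = μ} {ρ} P μ≢ρ = sym (begin
  coeff P ρ
    ≡⟨ coeff-eval P ρ ⟩
  eval (δ ρ) P
    ≡⟨ eval-without (δ ρ) μ P ⟩
  coeff P μ ℚ.* δ ρ μ ℚ.+ eval (δ ρ) (without μ P)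
    ≡⟨ cong (ℚ._+ eval (δ ρ) (without μ P))
         (trans (cong (coeff P μ ℚ.*_) (δ-≢ μ≢ρ)) (ℚₚ.*-zeroʳ (coeff P μ))) ⟩
  0ℚ ℚ.+ eval (δ ρ) (without μ P)
    ≡⟨ ℚₚ.+-identityˡ _ ⟩
  eval (δ ρ) (without μ P)
    ≡⟨ coeff-eval (without μ P) ρ ⟨
  coeff (without μ P) ρ ∎)

-- Terms may cancel, so a monomial in the list can lie outside the support. Stripping all terms with
-- the head monomial at once leaves its total coefficient; where that is zero, both sides contribute
-- zero. The bound `k` on the length makes the recursion structural.
eval-cong : ∀ {f g} (P : Poly m) → (∀ {μ} → Supp P μ → f μ ≡ g μ) → eval f P ≡ eval g P
eval-cong {m} {f} {g} P = go (length P) P ℕₚ.≤-refl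
  where
  go : ∀ k (P : Poly m) → length P ℕ.≤ k →
       (∀ {μ} → Supp P μ → f μ ≡ g μ) → eval f P ≡ eval g P
  go _       []                _       _   = refl
  go (suc k) P@((a , μ) ∷ P₀) (s≤s l) f≗g = begin
    eval f P
      ≡⟨ eval-without f μ P ⟩
    coeff P μ ℚ.* f μ ℚ.+ eval f (without μ P)
      ≡⟨ cong₂ ℚ._+_ head (go k (without μ P) shorter rest) ⟩
    coeff P μ ℚ.* g μ ℚ.+ eval g (without μ P)
      ≡⟨ eval-without g μ P ⟨
    eval g P ∎
    where
    head : coeff P μ ℚ.* f μ ≡ coeff P μ ℚ.* g μ
    head with supp? P μ
    ... | yes μ∈P = cong (coeff P μ ℚ.*_) (f≗g μ∈P)
    ... | no μ∉P  rewrite decidable-stable (coeff P μ ℚₚ.≟ 0ℚ) μ∉P =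
      trans (ℚₚ.*-zeroˡ (f μ)) (sym (ℚₚ.*-zeroˡ (g μ)))

    shorter : length (without μ P) ℕ.≤ k
    shorter = subst (λ Q → length Q ℕ.≤ k)
      (sym (filter-reject (λ t → ¬? (proj₂ t ≟ μ)) {xs = P₀} (λ μ≢μ → μ≢μ refl)))
      (ℕₚ.≤-trans (length-filter _ P₀) l)

    rest : ∀ {ν} → Supp (without μ P) ν → f ν ≡ g ν
    rest {ν} ν∈ with μ ≟ ν
    ... | yes refl = contradiction (coeff-without-≡ μ P) ν∈
    ... | no μ≢ν   = f≗g (λ eq → ν∈ (trans (coeff-without-≢ P μ≢ν) eq))

-- By the hypothesis, the double sum over the two supports has no summand other than the one at `μ`
-- and `ν`.
coeff-* : ∀ (P Q : Poly m) {μ ν} →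
          (∀ {μ′ ν′} → Supp P μ′ → Supp Q ν′ → μ′ ⊕ ν′ ≡ μ ⊕ ν → μ′ ≡ μ × ν′ ≡ ν) →
          coeff (P * Q) (μ ⊕ ν) ≡ coeff P μ ℚ.* coeff Q ν
coeff-* P Q {μ} {ν} unique = begin
  coeff (P * Q) (μ ⊕ ν)
    ≡⟨ coeff-eval (P * Q) (μ ⊕ ν) ⟩
  eval (δ (μ ⊕ ν)) (P * Q)
    ≡⟨ eval-* (δ (μ ⊕ ν)) P Q ⟩
  eval (λ μ′ → eval (λ ν′ → δ (μ ⊕ ν) (μ′ ⊕ ν′)) Q) P
    ≡⟨ eval-cong P inner ⟩
  eval (λ μ′ → δ μ μ′ ℚ.* coeff Q ν) P
    ≡⟨ eval-*ʳ (coeff Q ν) (δ μ) P ⟩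
  eval (δ μ) P ℚ.* coeff Q ν
    ≡⟨ cong (ℚ._* coeff Q ν) (coeff-eval P μ) ⟨
  coeff P μ ℚ.* coeff Q ν ∎
  where
  inner : ∀ {μ′} → Supp P μ′ →
          eval (λ ν′ → δ (μ ⊕ ν) (μ′ ⊕ ν′)) Q ≡ δ μ μ′ ℚ.* coeff Q ν
  inner {μ′} μ′∈P with μ′ ≟ μ
  ... | yes refl = trans (eval-cong Q same)
    (trans (sym (coeff-eval Q ν)) (sym (ℚₚ.*-identityˡ _)))
    where
    same : ∀ {ν′} → Supp Q ν′ → δ (μ ⊕ ν) (μ ⊕ ν′) ≡ δ ν ν′
    same {ν′} ν′∈Q with ν′ ≟ ν
    ... | yes refl = δ-≡ (μ ⊕ ν)
    ... | no ν′≢ν  = δ-≢ λ eq → ν′≢ν (proj₂ (unique μ′∈P ν′∈Q eq))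
  ... | no μ′≢μ = trans
    (eval-cong Q (λ ν′∈Q → δ-≢ λ eq → μ′≢μ (proj₁ (unique μ′∈P ν′∈Q eq))))
    (trans (eval-0 Q) (sym (ℚₚ.*-zeroˡ (coeff Q ν))))

*-nonzero : ∀ {p q} → p ≢ 0ℚ → q ≢ 0ℚ → p ℚ.* q ≢ 0ℚ
*-nonzero {p} {q} p≢0 q≢0 pq≡0 = q≢0 (begin
  q                        ≡⟨ ℚₚ.*-identityˡ q ⟨
  1ℚ ℚ.* q                 ≡⟨ cong (ℚ._* q) (ℚₚ.*-inverseˡ p) ⟨
  ℚ.1/ p ℚ.* p ℚ.* q       ≡⟨ ℚₚ.*-assoc (ℚ.1/ p) p q ⟩
  ℚ.1/ p ℚ.* (p ℚ.* q)     ≡⟨ cong (ℚ.1/ p ℚ.*_) pq≡0 ⟩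
  ℚ.1/ p ℚ.* 0ℚ            ≡⟨ ℚₚ.*-zeroʳ (ℚ.1/ p) ⟩
  0ℚ                       ∎)
  where instance _ = ℚ.≢-nonZero p≢0

supp-*⁺ : ∀ (P Q : Poly m) {μ ν} → Supp P μ → Supp Q ν →
          (∀ {μ′ ν′} → Supp P μ′ → Supp Q ν′ → μ′ ⊕ ν′ ≡ μ ⊕ ν → μ′ ≡ μ × ν′ ≡ ν) →
          Supp (P * Q) (μ ⊕ ν)
supp-*⁺ P Q μ∈P ν∈Q unique eq = *-nonzero μ∈P ν∈Q (trans (sym (coeff-* P Q unique)) eq)

-- If the tail has coefficient zero at `ρ`, the head must supply it. That `a` is nonzero lets
-- `supp-κ⁻` discard the zero term of `∑`.
supp⇒term : ∀ (P : Poly m) {ρ} → Supp P ρ → ∃ λ a → a ≢ 0ℚ × (a , ρ) ∈ˡ P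
supp⇒term []            ρ∈P = contradiction refl ρ∈P
supp⇒term ((a , μ) ∷ P) {ρ} ρ∈P with supp? P ρ
... | yes ρ∈P₀ = let b , b≢0 , t∈P = supp⇒term P ρ∈P₀ in b , b≢0 , there t∈P
... | no ρ∉P₀ with μ ≟ ρ
...   | yes refl = a , (λ { refl → ρ∈P (trans (ℚₚ.+-identityˡ _)
  (decidable-stable (coeff P ρ ℚₚ.≟ 0ℚ) ρ∉P₀)) }) , here refl
...   | no _     = contradiction ρ∈P ρ∉P₀

support : Poly m → List (Monomial m)
support P = filter (supp? P) (map proj₂ P)

∈-support : ∀ (P : Poly m) {μ} → Supp P μ → μ ∈ˡ support P
∈-support P μ∈P =
  let _ , _ , t∈P = supp⇒term P μ∈P in ∈-filter⁺ (supp? P) (∈-map⁺ proj₂ t∈P) μ∈P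

-- Supports are finite, so a pair can be searched for; if there is none, `δ ρ (μ ⊕ ν)` vanishes
-- throughout the double sum.
supp-*⁻ : ∀ (P Q : Poly m) {ρ} → Supp (P * Q) ρ →
          ∃₂ λ μ ν → Supp P μ × Supp Q ν × ρ ≡ μ ⊕ ν
supp-*⁻ P Q {ρ} ρ∈PQ with Any.any? (λ μ → Any.any? (λ ν → ρ ≟ μ ⊕ ν) (support Q)) (support P)
... | yes found =
  let μ , μ∈ , found′ = find found
      ν , ν∈ , eq     = find found′
  in μ , ν , proj₂ (∈-filter⁻ (supp? P) {xs = map proj₂ P} μ∈)
           , proj₂ (∈-filter⁻ (supp? Q) {xs = map proj₂ Q} ν∈) , eq
... | no none = contradiction
  (begin
    coeff (P * Q) ρ
      ≡⟨ coeff-eval (P * Q) ρ ⟩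
    eval (δ ρ) (P * Q)
      ≡⟨ eval-* (δ ρ) P Q ⟩
    eval (λ μ → eval (λ ν → δ ρ (μ ⊕ ν)) Q) P
      ≡⟨ eval-cong P (λ μ∈P → trans (eval-cong Q (λ ν∈Q → δ-≢ λ eq →
           none (lose (∈-support P μ∈P) (lose (∈-support Q ν∈Q) (sym eq))))) (eval-0 Q)) ⟩
    eval (λ _ → 0ℚ) P
      ≡⟨ eval-0 P ⟩
    0ℚ ∎)
  ρ∈PQ

-- Leading monomials and factors with disjoint variables

monomial-ext : ∀ {μ ν : Monomial m} → (∀ e → lookup μ e ≡ lookup ν e) → μ ≡ ν
monomial-ext {μ = μ} {ν} eq = trans (sym (Vecₚ.tabulate∘lookup μ))
  (trans (Vecₚ.tabulate-cong eq) (Vecₚ.tabulate∘lookup ν))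

lookup-⊕ : ∀ {μ ν μ′ ν′ : Monomial m} e → μ ⊕ ν ≡ μ′ ⊕ ν′ →
           lookup μ e ℕ.+ lookup ν e ≡ lookup μ′ e ℕ.+ lookup ν′ e
lookup-⊕ {μ = μ} {ν} {μ′} {ν′} e eq = trans (sym (Vecₚ.lookup-zipWith ℕ._+_ e μ ν))
  (trans (cong (λ ρ → lookup ρ e) eq) (Vecₚ.lookup-zipWith ℕ._+_ e μ′ ν′))

lexicographic : ℕ → TotalOrder _ _ _
lexicographic = Lex.≤-totalOrder ℕₚ.<-strictTotalOrder

infix 4 _≤ₗ_
_≤ₗ_ : Monomial k → Monomial k → Set
_≤ₗ_ = TotalOrder._≤_ (lexicographic _)

≤ₗ-head : ∀ {x y} {μ ν : Monomial k} → x ∷ μ ≤ₗ y ∷ ν → x ℕ.≤ y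
≤ₗ-head (this x<y _)    = ℕₚ.<⇒≤ x<y
≤ₗ-head (next refl _) = ℕₚ.≤-refl

-- The order is compatible with addition: at the first position where either inequality is strict,
-- the two sums would differ.
≤ₗ-⊕-cancel : ∀ {μ μ′ ν ν′ : Monomial k} → μ′ ≤ₗ μ → ν′ ≤ₗ ν →
              μ′ ⊕ ν′ ≡ μ ⊕ ν → μ′ ≡ μ × ν′ ≡ ν
≤ₗ-⊕-cancel (base _)       (base _)       _  = refl , refl
≤ₗ-⊕-cancel (this x<y _)   ν′≤ν@(this _ _) eq =
  contradiction (Vecₚ.∷-injectiveˡ eq) (ℕₚ.<⇒≢ (ℕₚ.+-mono-<-≤ x<y (≤ₗ-head ν′≤ν)))
≤ₗ-⊕-cancel (this x<y _)   ν′≤ν@(next _ _) eq =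
  contradiction (Vecₚ.∷-injectiveˡ eq) (ℕₚ.<⇒≢ (ℕₚ.+-mono-<-≤ x<y (≤ₗ-head ν′≤ν)))
≤ₗ-⊕-cancel (next refl _)  (this x<y _)   eq =
  contradiction (Vecₚ.∷-injectiveˡ eq) (ℕₚ.<⇒≢ (ℕₚ.+-mono-≤-< ℕₚ.≤-refl x<y))
≤ₗ-⊕-cancel (next refl p)  (next refl q)  eq =
  let μ≡ , ν≡ = ≤ₗ-⊕-cancel p q (Vecₚ.∷-injectiveʳ eq)
  in cong (_ ∷_) μ≡ , cong (_ ∷_) ν≡

-- Comparing keys is comparing monomials lexicographically with the variable e in front.
key : Fin m → Monomial m → Monomial (suc m)
key e μ = lookup μ e ∷ μ

-- With `e` in front, the leading monomial also has the greatest degree in `e`. The default value of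
-- `argmax` is `μ₀`, itself in the support, so the result always is.
leading : ∀ (P : Poly m) e {μ₀} → Supp P μ₀ →
          ∃ λ μ̂ → Supp P μ̂ × (∀ {μ} → Supp P μ → key e μ ≤ₗ key e μ̂)
leading {m} P e {μ₀} μ₀∈P = argmax (key e) μ₀ (support P)
  , argmax-all (key e) {P = Supp P} μ₀∈P (all-filter (supp? P) (map proj₂ P))
  , λ μ∈P → All.lookup (f[xs]≤f[argmax] {f = key e} μ₀ (support P)) (∈-support P μ∈P)
  where open Extrema (lexicographic (suc m))

Vanishes : Poly m → Fin m → Set
Vanishes P e = ∀ {μ} → Supp P μ → lookup μ e ≡ 0

-- The product of the leading monomials of P and Q occurs in P * Q, so degrees in e add.
affine⇒vanishes : ∀ (P Q : Poly m) e → (∀ {ρ} → Supp (P * Q) ρ → lookup ρ e ℕ.≤ 1) →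
                  ∀ {μ₀ ν₀} → Supp P μ₀ → Supp Q ν₀ → Vanishes P e ⊎ Vanishes Q e
affine⇒vanishes P Q e affine μ₀∈P ν₀∈Q
  with μ̂ , μ̂∈P , P≤μ̂ ← leading P e μ₀∈P | ν̂ , ν̂∈Q , Q≤ν̂ ← leading Q e ν₀∈Q
  = split (subst (ℕ._≤ 1) (Vecₚ.lookup-zipWith ℕ._+_ e μ̂ ν̂)
      (affine (supp-*⁺ P Q μ̂∈P ν̂∈Q λ μ∈P ν∈Q eq →
        let μ≡ , ν≡ = ≤ₗ-⊕-cancel (P≤μ̂ μ∈P) (Q≤ν̂ ν∈Q) (cong₂ _∷_ (lookup-⊕ e eq) eq)
        in Vecₚ.∷-injectiveʳ μ≡ , Vecₚ.∷-injectiveʳ ν≡)))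
      (λ μ∈P → ≤ₗ-head (P≤μ̂ μ∈P)) (λ ν∈Q → ≤ₗ-head (Q≤ν̂ ν∈Q))
  where
  split : ∀ {a b} → a ℕ.+ b ℕ.≤ 1 →
          (∀ {μ} → Supp P μ → lookup μ e ℕ.≤ a) →
          (∀ {ν} → Supp Q ν → lookup ν e ℕ.≤ b) →
          Vanishes P e ⊎ Vanishes Q e
  split {zero}        _       P≤ _  = inj₁ λ μ∈P → ℕₚ.n≤0⇒n≡0 (P≤ μ∈P)
  split {suc a} {b} (s≤s l) _  Q≤ = inj₂ λ ν∈Q →
    ℕₚ.n≤0⇒n≡0 (ℕₚ.≤-trans (Q≤ ν∈Q) (ℕₚ.≤-trans (ℕₚ.m≤n+m b a) l))

-- Each variable has exponent zero in one factor, so its exponent in the product is that in the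
-- other. The product therefore determines both monomials, and nothing cancels.
supp-*-disjoint : ∀ (P Q : Poly m) → (∀ e → Vanishes P e ⊎ Vanishes Q e) →
                  ∀ {μ ν} → Supp P μ → Supp Q ν → Supp (P * Q) (μ ⊕ ν)
supp-*-disjoint P Q disjoint {μ} {ν} μ∈P ν∈Q = supp-*⁺ P Q μ∈P ν∈Q λ μ′∈P ν′∈Q eq →
  monomial-ext (λ e → proj₁ (pointwise μ′∈P ν′∈Q eq e)) ,
  monomial-ext (λ e → proj₂ (pointwise μ′∈P ν′∈Q eq e))
  where
  pointwise : ∀ {μ′ ν′} → Supp P μ′ → Supp Q ν′ → μ′ ⊕ ν′ ≡ μ ⊕ ν →
              ∀ e → lookup μ′ e ≡ lookup μ e × lookup ν′ e ≡ lookup ν e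
  pointwise {μ′} {ν′} μ′∈P ν′∈Q eq e with disjoint e
  ... | inj₁ P=0 = let μ≡ = trans (P=0 μ′∈P) (sym (P=0 μ∈P)) in μ≡ ,
    ℕₚ.+-cancelˡ-≡ (lookup μ e) _ _
      (trans (cong (ℕ._+ lookup ν′ e) (sym μ≡)) (lookup-⊕ e eq))
  ... | inj₂ Q=0 = let ν≡ = trans (Q=0 ν′∈Q) (sym (Q=0 ν∈Q)) in
    ℕₚ.+-cancelʳ-≡ (lookup ν e) _ _
      (trans (cong (lookup μ′ e ℕ.+_) (sym ν≡)) (lookup-⊕ e eq)) , ν≡

vanishes⇒constant : ∀ (P : Poly m) → (∀ e → Vanishes P e) → IsConstant P
vanishes⇒constant {m} P P=0 = coeff P 𝟘 , agree
  where
  𝟘 = replicate m 0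

  agree : P ≈ const (coeff P 𝟘)
  agree ρ with 𝟘 ≟ ρ
  ... | yes refl = sym (ℚₚ.+-identityʳ (coeff P 𝟘))
  ... | no 𝟘≢ρ   = decidable-stable (coeff P ρ ℚₚ.≟ 0ℚ) λ ρ∈P →
    𝟘≢ρ (monomial-ext λ e → trans (Vecₚ.lookup-replicate e 0) (sym (P=0 e ρ∈P)))

-- Nonnegative coefficients cannot cancel a positive one, whatever other terms share the monomial
-- `ρ`.
supp-nonneg⁺ : ∀ {P : Poly m} {a ρ} → All (λ t → 0ℚ ℚ.≤ proj₁ t) P →
               (a , ρ) ∈ˡ P → 0ℚ ℚ.< a → Supp P ρ
supp-nonneg⁺ {m} {P₀} {a} {ρ} nonneg t∈P 0<a eq = ℚₚ.<⇒≢ (positive P₀ nonneg t∈P) (sym eq)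
  where
  nonnegative : ∀ P → All (λ t → 0ℚ ℚ.≤ proj₁ t) P → 0ℚ ℚ.≤ coeff P ρ
  nonnegative []            []        = ℚₚ.≤-refl
  nonnegative ((b , μ) ∷ P) (0≤b ∷ h) with μ ≟ ρ
  ... | yes _ = ℚₚ.+-mono-≤ 0≤b (nonnegative P h)
  ... | no _  = nonnegative P h

  positive : ∀ P → All (λ t → 0ℚ ℚ.≤ proj₁ t) P → (a , ρ) ∈ˡ P → 0ℚ ℚ.< coeff P ρ
  positive ((b , μ) ∷ P) (0≤b ∷ h) t∈ with μ ≟ ρ | t∈
  ... | yes _  | here refl  = ℚₚ.+-mono-<-≤ 0<a (nonnegative P h)
  ... | yes _  | there t∈P₁ = ℚₚ.+-mono-≤-< 0≤b (positive P h t∈P₁)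
  ... | no μ≢ρ | here refl  = contradiction refl μ≢ρ
  ... | no _   | there t∈P₁ = positive P h t∈P₁

-- The Kirchhoff polynomial

exponents : List (Fin m) → Monomial m
exponents {m} = foldr (λ i μ → (replicate m 0 [ i ]≔ 1) ⊕ μ) (replicate m 0)

∏-var : ∀ (is : List (Fin m)) → ∏ is var ≡ (1ℚ , exponents is) ∷ []
∏-var []       = refl
∏-var (i ∷ is) rewrite ∏-var is = refl

lookup-exponents : ∀ {is : List (Fin m)} → Unique is → ∀ j →
                   (j ∈ˡ is × lookup (exponents is) j ≡ 1) ⊎
                   (j ∉ˡ is × lookup (exponents is) j ≡ 0)
lookup-exponents {is = []}     []          j = inj₂ ((λ ()) , Vecₚ.lookup-replicate j 0)
lookup-exponents {m} {i ∷ is} (i∉is ∷ u) j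
  rewrite Vecₚ.lookup-zipWith ℕ._+_ j (replicate m 0 [ i ]≔ 1) (exponents is)
  with j Finₚ.≟ i | lookup-exponents u j
... | yes refl | inj₁ (i∈is , _) = contradiction refl (All.lookup i∉is i∈is)
... | yes refl | inj₂ (_ , eq)   = inj₁ (here refl ,
  cong₂ ℕ._+_ (Vecₚ.lookup∘update i (replicate m 0) 1) eq)
... | no j≢i | inj₁ (j∈is , eq) = inj₁ (there j∈is ,
  cong₂ ℕ._+_ (trans (Vecₚ.lookup∘update′ j≢i (replicate m 0) 1) (Vecₚ.lookup-replicate j 0)) eq)
... | no j≢i | inj₂ (j∉is , eq) = inj₂
  ( (λ { (here j≡i) → j≢i j≡i ; (there j∈is) → j∉is j∈is })
  , cong₂ ℕ._+_ (trans (Vecₚ.lookup∘update′ j≢i (replicate m 0) 1) (Vecₚ.lookup-replicate j 0)) eq)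

-- This is the indicator vector of `A`.
χ : Subset m → Monomial m
χ {m} A = exponents (filter (_∈? A) (allFin m))

χ-values : ∀ (A : Subset m) e → (e ∈ A × lookup (χ A) e ≡ 1) ⊎ (lookup (χ A) e ≡ 0)
χ-values {m} A e
  with lookup-exponents (Uniqueₚ.filter⁺ (_∈? A) (Uniqueₚ.allFin⁺ m)) e
... | inj₁ (e∈ , eq) = inj₁ (proj₂ (∈-filter⁻ (_∈? A) {xs = allFin m} e∈) , eq)
... | inj₂ (_ , eq)  = inj₂ eq

χ-≤1 : ∀ (A : Subset m) e → lookup (χ A) e ℕ.≤ 1
χ-≤1 A e with χ-values A e
... | inj₁ (_ , eq) = ℕₚ.≤-reflexive eq
... | inj₂ eq       = ℕₚ.≤-trans (ℕₚ.≤-reflexive eq) z≤n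

∈⇒χ≡1 : ∀ {A : Subset m} {e} → e ∈ A → lookup (χ A) e ≡ 1
∈⇒χ≡1 {m} {A} {e} e∈A
  with lookup-exponents (Uniqueₚ.filter⁺ (_∈? A) (Uniqueₚ.allFin⁺ m)) e
... | inj₁ (_ , eq) = eq
... | inj₂ (e∉ , _) = contradiction (∈-filter⁺ (_∈? A) (∈-allFin e) e∈A) e∉

χ≢0⇒∈ : ∀ {A : Subset m} {e} → lookup (χ A) e ≢ 0 → e ∈ A
χ≢0⇒∈ {A = A} {e} ≢0 with χ-values A e
... | inj₁ (e∈A , _) = e∈A
... | inj₂ eq        = contradiction eq ≢0

∈-subsets : ∀ (A : Subset m) → A ∈ˡ subsets m
∈-subsets []            = here refl
∈-subsets (outside ∷ A) = ∈-++⁺ˡ (∈-map⁺ (outside ∷_) (∈-subsets A))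
∈-subsets (inside ∷ A)  =
  ∈-++⁺ʳ (map (outside ∷_) (subsets _)) (∈-map⁺ (inside ∷_) (∈-subsets A))

module _ (G : Digraph) where
  open Digraph G

  -- The trailing `const 0ℚ` is the initial value of the fold in `∑`.
  terms : List (Subset #E) → Poly #E
  terms As = map (λ A → 1ℚ , χ A) As ++ const 0ℚ

  κ≡terms : κ G ≡ terms (arb G)
  κ≡terms = go (arb G)
    where
    go : ∀ As → ∑ As (λ A → ∏ (filter (_∈? A) (allFin #E)) var) ≡ terms As
    go []       = refl
    go (A ∷ As) rewrite ∏-var (filter (_∈? A) (allFin #E)) = cong (_ ∷_) (go As)

  supp-κ⁺ : ∀ {A} → IsArborescence G A → Supp (κ G) (χ A)
  supp-κ⁺ {A} arbA rewrite κ≡terms = supp-nonneg⁺ (nonneg (arb G))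
    (∈-++⁺ˡ (∈-map⁺ _ (∈-filter⁺ (isArborescence? G) (∈-subsets A) arbA)))
    (from-yes (0ℚ ℚₚ.<? 1ℚ))
    where
    nonneg : ∀ As → All (λ t → 0ℚ ℚ.≤ proj₁ t) (terms As)
    nonneg []       = ℚₚ.≤-refl ∷ []
    nonneg (A ∷ As) = from-yes (0ℚ ℚₚ.≤? 1ℚ) ∷ nonneg As

  supp-κ⁻ : ∀ {ρ} → Supp (κ G) ρ → ∃ λ A → IsArborescence G A × ρ ≡ χ A
  supp-κ⁻ ρ∈κ with supp⇒term (κ G) ρ∈κ
  ... | a , a≢0 , t∈κ
    with ∈-++⁻ (map (λ A → 1ℚ , χ A) (arb G)) (subst ((a , _) ∈ˡ_) κ≡terms t∈κ)
  ...   | inj₂ (here eq) = contradiction (cong proj₁ eq) a≢0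
  ...   | inj₁ t∈ with A , A∈arb , eq ← ∈-map⁻ _ t∈ =
    A , proj₂ (∈-filter⁻ (isArborescence? G) {xs = subsets #E} A∈arb) , cong proj₂ eq

-- Arborescences

least : ∀ {p} {P : Pred ℕ p} → Decidable P → ∀ n → P n →
        ∃ λ k → P k × (∀ {j} → P j → k ℕ.≤ j)
least P? n pn with P? 0
least P? n       pn | yes p₀ = 0 , p₀ , λ _ → z≤n
least P? zero    p₀ | no ¬p₀ = contradiction p₀ ¬p₀
least {P = P} P? (suc n) pn | no ¬p₀ with least (P? ∘ suc) n pn
... | k , pk , k≤ = suc k , pk , bound
  where
  bound : ∀ {j} → P j → suc k ℕ.≤ j
  bound {zero}  p₀ = contradiction p₀ ¬p₀
  bound {suc j} pj = s≤s (k≤ pj)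

subset : ∀ {n p} {P : Pred (Fin n) p} → Decidable P → Subset n
subset P? = tabulate (does ∘ P?)

∈-subset⁺ : ∀ {n p} {P : Pred (Fin n) p} (P? : Decidable P) {i} → P i → i ∈ subset P?
∈-subset⁺ P? {i} pi =
  Vecₚ.lookup⇒[]= i _ (trans (Vecₚ.lookup∘tabulate (does ∘ P?) i) (dec-true (P? i) pi))

∈-subset⁻ : ∀ {n p} {P : Pred (Fin n) p} (P? : Decidable P) {i} → i ∈ subset P? → P i
∈-subset⁻ P? {i} i∈
  with P? i | trans (sym (Vecₚ.lookup∘tabulate (does ∘ P?) i)) (Vecₚ.[]=⇒lookup i∈)
... | yes pi | _  = pi
... | no _   | ()

module _ (G : Digraph) where
  open Digraph G

  module _ {A : Subset #E} where

    snoc-path : ∀ {u} es {e} → IsPath G A u es (src e) → e ∈ A → IsPath G A u (es ∷ʳ e) (tgt e)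
    snoc-path []       refl              e∈A = e∈A , refl , refl
    snoc-path (_ ∷ es) (f∈A , s , path) e∈A = f∈A , s , snoc-path es path e∈A

    unsnoc-path : ∀ {u w} es {e} → IsPath G A u (es ∷ʳ e) w →
                  IsPath G A u es (src e) × e ∈ A × tgt e ≡ w
    unsnoc-path []       (e∈A , s , t)    = sym s , e∈A , t
    unsnoc-path (_ ∷ es) (f∈A , s , path) =
      let path′ , e∈A , t = unsnoc-path es path in (f∈A , s , path′) , e∈A , t

    -- Appending `e` to the path from the root to its source would give a second path from `r` to
    -- `r` besides the empty one.
    root-no-entry : ∀ {r e} → HasRoot G A r → e ∈ A → tgt e ≢ r
    root-no-entry {e = e} root e∈A refl =
      let es , path , _ = root (src e)
          _ , _ , unique = root (tgt e)
      in nil≢snoc es (trans (sym (unique refl)) (unique (snoc-path es path e∈A)))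
      where
      nil≢snoc : ∀ es → [] ≢ es ∷ʳ e
      nil≢snoc []      ()
      nil≢snoc (_ ∷ _) ()

    -- The paths to the two sources, extended by `e` and `f`, lead to the same vertex; they
    -- coincide, and so do their last edges.
    root-entry-unique : ∀ {r e f} → HasRoot G A r → e ∈ A → f ∈ A → tgt e ≡ tgt f → e ≡ f
    root-entry-unique {e = e} {f} root e∈A f∈A t =
      let es , pathₑ , _ = root (src e)
          fs , path_f , _ = root (src f)
          _ , _ , unique = root (tgt f)
      in ∷ʳ-injectiveʳ es fs (trans
           (sym (unique (subst (IsPath G A _ (es ∷ʳ e)) t (snoc-path es pathₑ e∈A))))
           (unique (snoc-path fs path_f f∈A)))

    root-entry : ∀ {r v} → HasRoot G A r → v ≢ r → ∃ λ e → e ∈ A × tgt e ≡ v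
    root-entry {r} {v} root v≢r with es , path , _ ← root v = go (reverseView es) path
      where
      go : ∀ {es} → Reverse es → IsPath G A r es v → ∃ λ e → e ∈ A × tgt e ≡ v
      go []             r≡v  = contradiction (sym r≡v) v≢r
      go (es ∶ _ ∶ʳ e) path = e , proj₂ (unsnoc-path es path)

    -- Following entering edges backwards lowers `depth`, so it ends at `r` and yields a path. Two
    -- paths to the same vertex are compared from their last edges, which agree by `entry-unique`;
    -- `no-entry` makes both reach `r` at the same moment.
    hasRoot : ∀ {r} (depth : V → ℕ) →
              (∀ {e} → e ∈ A → tgt e ≢ r) →
              (∀ {e f} → e ∈ A → f ∈ A → tgt e ≡ tgt f → e ≡ f) →
              (∀ {v} → v ≢ r → ∃ λ e → e ∈ A × tgt e ≡ v × depth (src e) ℕ.< depth v) →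
              HasRoot G A r
    hasRoot {r} depth no-entry entry-unique entry v =
      let es , path = reach v (<-wellFounded _) in
      es , path , λ {fs} → unique (reverseView es) (reverseView fs) path
      where
      reach : ∀ v → Acc ℕ._<_ (depth v) → ∃ λ es → IsPath G A r es v
      reach v (acc smaller) with v Finₚ.≟ r
      ... | yes v≡r = [] , sym v≡r
      ... | no v≢r with entry v≢r
      ...   | e , e∈A , refl , below =
        let es , path = reach (src e) (smaller below) in es ∷ʳ e , snoc-path es path e∈A

      unique : ∀ {es fs v} → Reverse es → Reverse fs →
               IsPath G A r es v → IsPath G A r fs v → es ≡ fs
      unique []             []             _    _    = refl
      unique []             (fs ∶ _ ∶ʳ f) refl q    =
        let _ , f∈A , t = unsnoc-path fs q in contradiction t (no-entry f∈A)
      unique (es ∶ _ ∶ʳ e) []             p    refl =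
        let _ , e∈A , t = unsnoc-path es p in contradiction t (no-entry e∈A)
      unique (es ∶ re ∶ʳ e) (fs ∶ rf ∶ʳ f) p   q
        with p′ , e∈A , tₑ ← unsnoc-path es p | q′ , f∈A , t_f ← unsnoc-path fs q
        with refl ← entry-unique e∈A f∈A (trans tₑ (sym t_f))
        = cong (_∷ʳ e) (unique re rf p′ q′)

  -- Arborescences of a strongly connected digraph

  module _ (connected : StronglyConnected G) where

    module _ (r : V) where

      -- Indexing by length makes existence decidable for each `k`, as `least` requires. The
      -- recursion peels off the last edge, which is what a parent edge has to be.
      Walk : ℕ → V → Set
      Walk zero    v = v ≡ r
      Walk (suc k) v = ∃ λ e → tgt e ≡ v × Walk k (src e)

      walk? : ∀ k v → Dec (Walk k v)
      walk? zero    v = v Finₚ.≟ r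
      walk? (suc k) v = Finₚ.any? λ e → (tgt e Finₚ.≟ v) ×-dec walk? k (src e)

      walk : ∀ v → ∃ λ k → Walk k v
      walk v with es , path ← proj₁ (connected r v) = extend es 0 refl path
        where
        -- The walk accumulates the part of the path already traversed, since paths grow at the
        -- front and walks at the end.
        extend : ∀ {u} es k → Walk k u → IsPath G ⊤ u es v → ∃ λ k → Walk k v
        extend []       k w refl              = k , w
        extend (e ∷ es) k w (_ , refl , path) = extend es (suc k) (e , refl , w) path

      -- Abstract so that the with-abstraction in parent-closer does not reach into distances.
      abstract
        nearest : ∀ v → ∃ λ k → Walk k v × (∀ {j} → Walk j v → k ℕ.≤ j)
        nearest v = let k , w = walk v in least (λ k → walk? k v) k w

      distance : V → ℕ
      distance v = proj₁ (nearest v)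

      -- The last edge of a shortest walk works: removing it leaves a walk to its source that is
      -- shorter by one.
      closer : ∀ {v} → v ≢ r → ∃ λ e → tgt e ≡ v × distance (src e) ℕ.< distance v
      closer {v} v≢r with nearest v
      ... | zero  , v≡r         , _ = contradiction v≡r v≢r
      ... | suc k , (e , t , w) , _ = e , t , s≤s (proj₂ (proj₂ (nearest (src e))) w)

      distance-pos : ∀ {v} → v ≢ r → distance r ℕ.< distance v
      distance-pos {v} v≢r with nearest v
      ... | zero  , v≡r , _ = contradiction v≡r v≢r
      ... | suc k , _   , _ = s≤s (ℕₚ.≤-trans (proj₂ (proj₂ (nearest r)) refl) z≤n)

    -- Take the tree of shortest walks from `src g`, but let `g` be the edge entering `tgt g`.
    -- Distances still decrease along `g` backwards, because its source is the root, at distance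
    -- zero.
    arborescence-at : ∀ g → ∃ λ A → HasRoot G A (src g) × g ∈ A
    arborescence-at g = A , hasRoot (distance r) no-entry entry-unique entry , g∈A
      where
      r = src g

      parent : V → Maybe E
      parent v with v Finₚ.≟ r | v Finₚ.≟ tgt g
      ... | yes _  | _     = nothing
      ... | no _   | yes _ = just g
      ... | no v≢r | no _  = just (proj₁ (closer r v≢r))

      -- An edge is kept when it is the parent of its own target. So kept edges with a common target
      -- coincide, and none enters `r`, which has no parent.
      isParent? : ∀ e → Dec (parent (tgt e) ≡ just e)
      isParent? e = Maybe-≡-dec Finₚ._≟_ (parent (tgt e)) (just e)

      A : Subset #E
      A = subset isParent?

      parent-root : parent r ≡ nothing
      parent-root with r Finₚ.≟ r | r Finₚ.≟ tgt g
      ... | yes _  | _ = refl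
      ... | no r≢r | _ = contradiction refl r≢r

      parent-tgt : parent (tgt g) ≡ just g
      parent-tgt with tgt g Finₚ.≟ r | tgt g Finₚ.≟ tgt g
      ... | yes t≡s | _       = contradiction (sym t≡s) (loopless g)
      ... | no _    | yes _   = refl
      ... | no _    | no t≢t = contradiction refl t≢t

      parent-closer : ∀ {v} → v ≢ r →
        ∃ λ e → parent v ≡ just e × tgt e ≡ v × distance r (src e) ℕ.< distance r v
      parent-closer {v} v≢r with v Finₚ.≟ r | v Finₚ.≟ tgt g
      ... | yes v≡r | _        = contradiction v≡r v≢r
      ... | no v≢r′ | yes refl = g , refl , refl , distance-pos r v≢r′
      ... | no v≢r′ | no _     = _ , refl , proj₂ (closer r v≢r′)

      g∈A : g ∈ A
      g∈A = ∈-subset⁺ isParent? parent-tgt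

      no-entry : ∀ {e} → e ∈ A → tgt e ≢ r
      no-entry {e} e∈A t≡r with () ←
        trans (sym parent-root) (trans (cong parent (sym t≡r)) (∈-subset⁻ isParent? e∈A))

      entry-unique : ∀ {e f} → e ∈ A → f ∈ A → tgt e ≡ tgt f → e ≡ f
      entry-unique e∈A f∈A t = just-injective (trans (sym (∈-subset⁻ isParent? e∈A))
        (trans (cong parent t) (∈-subset⁻ isParent? f∈A)))

      entry : ∀ {v} → v ≢ r →
              ∃ λ e → e ∈ A × tgt e ≡ v × distance r (src e) ℕ.< distance r v
      entry v≢r with parent-closer v≢r
      ... | e , eq , refl , below = e , ∈-subset⁺ isParent? eq , refl , below

    -- The path from `tgt e` back to `src e` is nonempty, as there are no loops, and its first edge
    -- has source `tgt e`.
    arborescence-rooted-at-tgt : ∀ e → ∃ λ A → HasRoot G A (tgt e)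
    arborescence-rooted-at-tgt e with proj₁ (connected (tgt e) (src e))
    ... | []    , t≡s          = contradiction (sym t≡s) (loopless e)
    ... | g ∷ _ , (_ , s , _) =
      let A , root , _ = arborescence-at g in A , subst (HasRoot G A) s root

    -- This is the form in which a factorization of `κ G` enters the combinatorics: `false` will
    -- mark edges absent from `Q`, and `true` edges absent from `P`.
    Exchange : (E → Bool) → Set
    Exchange side = ∀ {A A′} → IsArborescence G A → IsArborescence G A′ →
      ∃ λ B → IsArborescence G B ×
        (∀ {e} → side e ≡ false → e ∈ A → e ∈ B) × (∀ {e} → side e ≡ true → e ∈ A′ → e ∈ B)

    module _ {side : E → Bool} (exchange : Exchange side) where

      -- Arborescences through `e` and through `f` combine to one containing both. With a common
      -- target the two edges would be equal, yet their sides differ.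
      sides-differ⇒tgt-≢ : ∀ {e f} → side e ≡ false → side f ≡ true → tgt e ≢ tgt f
      sides-differ⇒tgt-≢ {e} {f} eˢ fˢ t
        with A  , rootA  , e∈A  ← arborescence-at e
           | A′ , rootA′ , f∈A′ ← arborescence-at f
        with B , (_ , rootB) , A⊆B , A′⊆B ← exchange (_ , rootA) (_ , rootA′)
        with refl ← root-entry-unique rootB (A⊆B eˢ e∈A) (A′⊆B fˢ f∈A′) t
        with () ← trans (sym eˢ) fˢ

      -- All edges entering a given vertex have the same side. The roots are chosen so that `A`
      -- fails to enter only a vertex of side `true`, and `A′` only one of side `false`. The `false`
      -- part of `A` and the `true` part of `A′` thus enter every vertex, including the root of `B`.
      sides-agree : ∀ {e f} → side e ≡ false → side f ≡ true → ⊥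
      sides-agree {e} {f} eˢ fˢ
        with A  , rootA  ← arborescence-rooted-at-tgt f
           | A′ , rootA′ ← arborescence-rooted-at-tgt e
        with B , (root , rootB) , A⊆B , A′⊆B ← exchange (_ , rootA) (_ , rootA′)
        = let g , g∈B , t = enter root in root-no-entry rootB g∈B t
        where
        -- The root of `A′` is the target of the `false` edge `e`, hence not that of `g`. So `A′`
        -- enters `tgt g`, and by an edge on the side of `g`.
        enter-true : ∀ {g} → side g ≡ true → ∃ λ h → h ∈ B × tgt h ≡ tgt g
        enter-true {g} gˢ
          with h , h∈A′ , t ← root-entry rootA′ (sides-differ⇒tgt-≢ eˢ gˢ ∘ sym)
          with side h in hˢ
        ... | true  = h , A′⊆B hˢ h∈A′ , t
        ... | false = contradiction t (sides-differ⇒tgt-≢ hˢ gˢ)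

        enter : ∀ v → ∃ λ g → g ∈ B × tgt g ≡ v
        enter v with v Finₚ.≟ tgt f
        ... | yes refl = enter-true fˢ
        ... | no v≢f with g , g∈A , refl ← root-entry rootA v≢f with side g in gˢ
        ...   | true  = enter-true gˢ
        ...   | false = g , A⊆B gˢ g∈A , refl

-- Factorizations of the Kirchhoff polynomial

theorem3p4 : (G : Digraph) → StronglyConnected G → Prime (κ G)
theorem3p4 G connected P Q κ≈PQ = one-sided (Finₚ.all? λ e → side e Boolₚ.≟ true)
  where
  open Digraph G

  abstract
    arb⇒supp : ∀ {A} → IsArborescence G A → Supp (P * Q) (χ A)
    arb⇒supp {A} arbA eq = supp-κ⁺ G arbA (trans (κ≈PQ (χ A)) eq)

    supp⇒arb : ∀ {ρ} → Supp (P * Q) ρ → ∃ λ A → IsArborescence G A × ρ ≡ χ A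
    supp⇒arb {ρ} ρ∈PQ = supp-κ⁻ G λ eq → ρ∈PQ (trans (sym (κ≈PQ ρ)) eq)

    affine : ∀ e {ρ} → Supp (P * Q) ρ → lookup ρ e ℕ.≤ 1
    affine e ρ∈PQ with A , _ , refl ← supp⇒arb ρ∈PQ = χ-≤1 A e

    disjoint : ∀ e → Vanishes P e ⊎ Vanishes Q e
    disjoint e =
      -- Leading monomials exist only for nonzero factors. An arborescence through `e` gives a
      -- monomial of `P * Q`, hence monomials of `P` and of `Q`.
      let A , rootA , _ = arborescence-at G connected e
          μ , ν , μ∈P , ν∈Q , _ = supp-*⁻ P Q (arb⇒supp (_ , rootA))
      in affine⇒vanishes P Q e (affine e) μ∈P ν∈Q

  side : E → Bool
  side e with disjoint e
  ... | inj₁ _ = true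
  ... | inj₂ _ = false

  P-vanishes : ∀ {e} → side e ≡ true → Vanishes P e
  P-vanishes {e} eq with inj₁ P=0 ← disjoint e = P=0

  Q-vanishes : ∀ {e} → side e ≡ false → Vanishes Q e
  Q-vanishes {e} eq with inj₂ Q=0 ← disjoint e = Q=0

  -- Write `χ A` as `μ ⊕ ν` and `χ A′` as `μ′ ⊕ ν′`. The mixed product `μ ⊕ ν′` also occurs in
  -- `P * Q`, so it is `χ B` for an arborescence `B`. On the side `false` the exponents of `χ A` are
  -- those of `μ`; on the side `true` those of `χ A′` are those of `ν′`.
  exchange : Exchange G connected side
  exchange {A} {A′} arbA arbA′
    with μ  , ν  , μ∈P  , ν∈Q  , A≡  ← supp-*⁻ P Q (arb⇒supp arbA)
       | μ′ , ν′ , μ′∈P , ν′∈Q , A′≡ ← supp-*⁻ P Q (arb⇒supp arbA′)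
    with B , arbB , B≡ ← supp⇒arb (supp-*-disjoint P Q disjoint μ∈P ν′∈Q)
    = B , arbB
    , (λ {e} eˢ e∈A → ∈B e (inj₁ (begin
        lookup μ e                 ≡⟨ ℕₚ.+-identityʳ _ ⟨
        lookup μ e ℕ.+ 0           ≡⟨ cong (lookup μ e ℕ.+_) (Q-vanishes eˢ ν∈Q) ⟨
        lookup μ e ℕ.+ lookup ν e  ≡⟨ Vecₚ.lookup-zipWith ℕ._+_ e μ ν ⟨
        lookup (μ ⊕ ν) e           ≡⟨ cong (λ ρ → lookup ρ e) A≡ ⟨
        lookup (χ A) e             ≡⟨ ∈⇒χ≡1 e∈A ⟩
        1                          ∎)))
    , (λ {e} eˢ e∈A′ → ∈B e (inj₂ (begin
        lookup ν′ e                  ≡⟨ cong (ℕ._+ lookup ν′ e) (P-vanishes eˢ μ′∈P) ⟨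
        lookup μ′ e ℕ.+ lookup ν′ e  ≡⟨ Vecₚ.lookup-zipWith ℕ._+_ e μ′ ν′ ⟨
        lookup (μ′ ⊕ ν′) e           ≡⟨ cong (λ ρ → lookup ρ e) A′≡ ⟨
        lookup (χ A′) e              ≡⟨ ∈⇒χ≡1 e∈A′ ⟩
        1                            ∎)))
    where
    ∈B : ∀ e → lookup μ e ≡ 1 ⊎ lookup ν′ e ≡ 1 → e ∈ B
    ∈B e one = χ≢0⇒∈ λ zero′ → nonzero one (begin
      lookup μ e ℕ.+ lookup ν′ e  ≡⟨ Vecₚ.lookup-zipWith ℕ._+_ e μ ν′ ⟨
      lookup (μ ⊕ ν′) e           ≡⟨ cong (λ ρ → lookup ρ e) B≡ ⟩
      lookup (χ B) e              ≡⟨ zero′ ⟩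
      0                           ∎)
      where
      nonzero : ∀ {a b} → a ≡ 1 ⊎ b ≡ 1 → a ℕ.+ b ≢ 0
      nonzero         (inj₁ refl) ()
      nonzero {zero}  (inj₂ refl) ()
      nonzero {suc _} (inj₂ refl) ()

  -- A digraph without edges falls under the first case. In the second, one edge of side `false`
  -- forces all others to that side.
  one-sided : Dec (∀ e → side e ≡ true) → IsConstant P ⊎ IsConstant Q
  one-sided (yes all-true) = inj₁ (vanishes⇒constant P λ e → P-vanishes (all-true e))
  one-sided (no ¬all-true)
    with f , fˢ ← Finₚ.¬∀⟶∃¬ _ _ (λ e → side e Boolₚ.≟ true) ¬all-true =
    inj₂ (vanishes⇒constant Q λ e → Q-vanishes (Boolₚ.¬-not λ eˢ →
      sides-agree G connected exchange (Boolₚ.¬-not fˢ) eˢ))
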